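{- Let $G$ be a connected simple cubic graph of girth 4, let $M(G)$ be a $\Pi$-map of $G$, and let $\mu$ be an ETGC of $M(G)$ with vertex coloring $\mu_V=\mu|_{V(G)}$. Then, corresponding to $\mu_V$, there are two mutually orthogonal edge colorings $\mu^D$ and $\mu^R$ of $E(G)$ leading to two mutually orthogonal ETGCs, namely a DETGC $\mu_V^D=(\mu_V,\mu^D)$ and an RETGC $\mu_V^R=(\mu_V,\mu^R)$. Moreover, either $\mu=\mu_V^D$ or $\mu=\mu_V^R$.
   Context: Write $[3]_0=\{0,1,2,3\}$. $G$ is a connected simple cubic graph of girth 4. A set $S_0\subseteq V(G)$ is an efficient dominating set (EDS) if $|N_G[v]\cap S_0|=1$ for every $v\in V(G)$. A total coloring colors vertices and edges so that no two incident or adjacent elements get the same color. An efficient total coloring (ETC) of $G$ is a total coloring $\mu:V(G)\cup E(G)\to[3]_0$ such that for each vertex $v$ the restriction of $\mu$ to $N_G[v]$ is a bijection onto $[3]_0$, and the four vertex color classes partition $V(G)$ into EDSs. An ETGC is an ETC in which every 4-cycle of $G$ has each of the four colors exactly once on its vertices and exactly once on its edges. Two ETCs are mutually orthogonal if they have the same vertex coloring and differ in color on every edge; their induced edge colorings are then also called mutually orthogonal. A map $M(G)$ is an embedding of $G$ in a connected closed orientable surface $S$ of genus equal to the genus of $G$ such that the components of $S\setminus G$ are open disks; closures of these disks are the faces, and a belt is a face boundary cycle (an $\ell$-belt if it has length $\ell$). A vertex of $G$ in no 4-cycle of $G$ is a Y-vertex; an edge with both ends Y-vertices is a Y-edge.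 A $2\ell$-belt with consecutive edges $(e_1,\dots,e_{2\ell})$ is a Y-belt if its Y-edges, if any, occur only in opposite pairs $\{e_h,e_{h+\ell}\}$, $1\le h\le\ell$. $M(G)$ is a Y-map if all belts have even length and are Y-belts. A $\Pi$-map is a Y-map $M(G)$ for which $V(G)$ admits a partition into four EDSs, labelled $0,1,2,3$, such that the cyclic sequence of vertex colors of each $\ell$-belt has the form $(a,b,c,d)^{\ell/4}$ with $\{a,b,c,d\}=[3]_0$. Given an ETGC of a $\Pi$-map, a belt is directed (resp. reversed) if each color-0 edge $e$ on it lies in the clockwise (resp. counterclockwise) direction from a color-0 vertex $v$ of the belt, with distance 1 from $v$ to the nearest end-vertex of $e$. (Clockwise is with respect to the orientation of the face.) An ETGC is a DETGC (resp. RETGC) if every belt is directed (resp. reversed).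
   Formalization: The vertex coloring μ_V of the ETGC is required to be a partition into four EDSs that makes M(G) a Π-map (belts read (a,b,c,d)^{ℓ/4} under μ_V); for an arbitrary ETGC of a Π-map the claim fails, e.g. on toroidal 4.8.8 tilings. -}

module Defs where

open import Data.Bool using (Bool; T)
open import Data.Fin using (Fin; toℕ)
open import Data.Fin.Patterns using (0F)
open import Data.Fin.Properties using (_≟_)
open import Data.Fin.Subset using (Subset; _∈_; _∩_; _∪_; ⁅_⁆; ∣_∣)
open import Data.List using (map; allFin)
open import Data.Nat using (ℕ; suc; _+_; _*_; _≤_; _<_; _/_)
open import Data.Nat.DivMod using (_mod_)
open import Data.Nat.ListAction using (sum)
open import Data.Product using (Σ; ∃-syntax; ∃!; _×_; proj₁)
open import Data.Vec using (tabulate)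
import Function.Endo.Propositional as Endo
open import Function.Bundles using (_⇔_)
open import Function.Definitions using (Injective; Surjective; Bijective)
open import Relation.Binary.Construct.Closure.ReflexiveTransitive using (Star)
open import Relation.Binary.PropositionalEquality using (_≡_; _≢_; _≗_)
open import Relation.Nullary using (¬_; does)

_⟪_⟫ : {A : Set} → (A → A) → ℕ → A → A
_⟪_⟫ {A} = Endo._^_ A

-- Cyclic successor: the last index is followed by 0.
next : ∀ {k} → Fin k → Fin k
next {suc k} i = suc (toℕ i) mod suc k

record Graph : Set where
  field
    order  : ℕ
    adj    : Fin order → Fin order → Bool
    irrefl : ∀ v → ¬ T (adj v v)
    symm   : ∀ {u v} → T (adj u v) → T (adj v u)

  V : Set
  V = Fin order

  Adj : V → V → Set
  Adj u v = T (adj u v)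

  N : V → Subset order
  N v = tabulate (adj v)

  N[_] : V → Subset order
  N[ v ] = ⁅ v ⁆ ∪ N v

  degree : V → ℕ
  degree v = ∣ N v ∣

  -- The number of edges, by the handshake lemma.
  size : ℕ
  size = sum (map degree (allFin order)) / 2

open Graph public using (order)

module _ (G : Graph) where
  open Graph G hiding (order)

  -- An edge uv gives two darts, u → v and v → u.
  record Dart : Set where
    constructor dart
    field
      tail head : V
      arc       : Adj tail head

  open Dart public

  rev : Dart → Dart
  rev (dart u v a) = dart v u (symm a)

  Connected : Set
  Connected = ∀ u v → Star Adj u v

  Cubic : Set
  Cubic = ∀ v → degree v ≡ 3

  record Cycle (k : ℕ) : Set where
    field
      long     : 3 ≤ k
      vertex   : Fin k → V
      distinct : Injective _≡_ _≡_ vertex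
      adjacent : ∀ i → Adj (vertex i) (vertex (next i))

    edge : Fin k → Dart
    edge i = dart (vertex i) (vertex (next i)) (adjacent i)

  Girth : ℕ → Set
  Girth g = Cycle g × (∀ {k} → k < g → ¬ Cycle k)

  YVertex : V → Set
  YVertex v = ∀ (C : Cycle 4) i → Cycle.vertex C i ≢ v

  YEdge : Dart → Set
  YEdge d = YVertex (tail d) × YVertex (head d)

  -- A cellular embedding in an oriented closed surface, as a rotation system:
  -- rot d is the dart following d counterclockwise around tail d.  Hence φ d is
  -- the dart following d when the face to the right of d is traversed clockwise,
  -- and the faces are the orbits of φ.
  record Embedding : Set where
    field
      rot        : Dart → Dart
      rot-tail   : ∀ d → tail (rot d) ≡ tail d
      rot-cyclic : ∀ d e → tail d ≡ tail e → ∃[ k ] (rot ⟪ k ⟫) d ≡ e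

    φ : Dart → Dart
    φ d = rot (rev d)

    field
      faces       : ℕ
      face        : Dart → Fin faces
      face-onto   : Surjective _≡_ _≡_ face
      face-orbits : ∀ d e → face d ≡ face e ⇔ (∃[ k ] (φ ⟪ k ⟫) d ≡ e)

  -- Euler's formula |V| - |E| + |F| = 2 - 2g.
  HasGenus : Embedding → ℕ → Set
  HasGenus M g = order G + Embedding.faces M + 2 * g ≡ size + 2

  _isGenusOfGraph : ℕ → Set
  g isGenusOfGraph =
    (∃[ M ] HasGenus M g) × (∀ M′ g′ → HasGenus M′ g′ → g ≤ g′)

  module _ (M : Embedding) where
    open Embedding M

    -- The belt traversed clockwise from the dart d: the facial walk through d,
    -- which has to be a cycle of G.  Its i-th edge and vertex are indexed by all
    -- i : ℕ and repeat with period `length`.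
    record Belt (d : Dart) : Set where
      field
        length   : ℕ
        closes   : (φ ⟪ length ⟫) d ≡ d
        boundary : Cycle length
        traces   : ∀ i → Cycle.vertex boundary i ≡ tail ((φ ⟪ toℕ i ⟫) d)

      edge : ℕ → Dart
      edge i = (φ ⟪ i ⟫) d

      vertex : ℕ → V
      vertex i = tail (edge i)

    record IsMap : Set where
      field
        minimal-genus : ∃[ g ] HasGenus M g × g isGenusOfGraph
        belt          : ∀ d → Belt d

    IsYBelt : ∀ {d} → Belt d → Set
    IsYBelt B = ∃[ ℓ ] length ≡ 2 * ℓ × (∀ h → YEdge (edge h) ⇔ YEdge (edge (h + ℓ)))
      where open Belt B

    record IsYMap : Set where
      field
        isMap  : IsMap
        yBelts : ∀ {d} (B : Belt d) → IsYBelt B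

  Colour : Set
  Colour = Fin 4

  class : (V → Colour) → Colour → Subset (order G)
  class κ c = tabulate (λ v → does (κ v ≟ c))

  IsEDS : Subset (order G) → Set
  IsEDS S = ∀ v → ∣ N[ v ] ∩ S ∣ ≡ 1

  IsEDSPartition : (V → Colour) → Set
  IsEDSPartition κ = ∀ c → IsEDS (class κ c)

  record EdgeColouring : Set where
    field
      colour     : Dart → Colour
      colour-rev : ∀ d → colour (rev d) ≡ colour d

  open EdgeColouring public

  record Colouring : Set where
    constructor ⟨_,_⟩
    field
      onV : V → Colour
      onE : EdgeColouring

  open Colouring public

  SameColouring : Colouring → Colouring → Set
  SameColouring μ ν = (onV μ ≗ onV ν) × (colour (onE μ) ≗ colour (onE ν))

  record IsTotal (μ : Colouring) : Set where
    field
      vertex-vertex : ∀ d → onV μ (tail d) ≢ onV μ (head d)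
      vertex-edge   : ∀ d → onV μ (tail d) ≢ colour (onE μ) d
      edge-edge     : ∀ d e → tail d ≡ tail e → head d ≢ head e →
                      colour (onE μ) d ≢ colour (onE μ) e

  record IsETC (μ : Colouring) : Set where
    field
      total      : IsTotal μ
      bijective  : ∀ v → Bijective _≡_ _≡_ (λ (w : ∃[ u ] u ∈ N[ v ]) → onV μ (proj₁ w))
      efficient  : IsEDSPartition (onV μ)

  record IsETGC (μ : Colouring) : Set where
    field
      isETC       : IsETC μ
      on-vertices : ∀ (C : Cycle 4) c → ∃! _≡_ λ i → onV μ (Cycle.vertex C i) ≡ c
      on-edges    : ∀ (C : Cycle 4) c → ∃! _≡_ λ i → colour (onE μ) (Cycle.edge C i) ≡ c

  OrthogonalEdgeColourings : EdgeColouring → EdgeColouring → Set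
  OrthogonalEdgeColourings ε ε′ = ∀ d → colour ε d ≢ colour ε′ d

  record Orthogonal (μ ν : Colouring) : Set where
    field
      isETCˡ        : IsETC μ
      isETCʳ        : IsETC ν
      same-vertices : onV μ ≗ onV ν
      edges-differ  : OrthogonalEdgeColourings (onE μ) (onE ν)

  module _ (M : Embedding) where

    -- The colours around the belt are (p 0, p 1, p 2, p 3), repeated q times.
    IsPeriodic : (V → Colour) → ∀ {d} → Belt M d → Set
    IsPeriodic κ B =
      ∃[ q ] length ≡ 4 * q ×
      (Σ (Fin 4 → Colour) λ p → Bijective _≡_ _≡_ p × (∀ i → κ (vertex i) ≡ p (i mod 4)))
      where open Belt B

    record IsΠMap : Set where
      field
        isYMap    : IsYMap M
        label     : V → Colour
        partition : IsEDSPartition label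
        periodic  : ∀ {d} (B : Belt M d) → IsPeriodic label B

  module _ {M : Embedding} (Π : IsΠMap M) where

    -- An ETGC of a Π-map colours the vertices by the labelled partition of the
    -- Π-map.
    record IsETGCOf (μ : Colouring) : Set where
      field
        isETGC : IsETGC μ
        labels : onV μ ≗ IsΠMap.label Π

    -- Clockwise from vertex j, the first end of edge i to be reached is its
    -- tail; counterclockwise it is its head.  Both have to be one step away.
    IsDirected : Colouring → ∀ {d} → Belt M d → Set
    IsDirected μ B =
      ∀ i → colour (onE μ) (edge i) ≡ 0F →
      ∃[ j ] onV μ (vertex j) ≡ 0F × vertex (suc j) ≡ tail (edge i)
      where open Belt B

    IsReversed : Colouring → ∀ {d} → Belt M d → Set
    IsReversed μ B =
      ∀ i → colour (onE μ) (edge i) ≡ 0F →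
      ∃[ j ] onV μ (vertex (suc j)) ≡ 0F × vertex j ≡ head (edge i)
      where open Belt B

    record IsDETGC (μ : Colouring) : Set where
      field
        isETGCOf : IsETGCOf μ
        directed : ∀ {d} (B : Belt M d) → IsDirected μ B

    record IsRETGC (μ : Colouring) : Set where
      field
        isETGCOf : IsETGCOf μ
        reversed : ∀ {d} (B : Belt M d) → IsReversed μ B

{-# OPTIONS --safe #-}
module Submission where

-- Write h d for the colour of the head of a dart d.  Every closed neighbourhood
-- carries each colour once, so the darts d, rot d, rot² d at a vertex u have
-- three different head colours, none of them that of u, and rot³ is the
-- identity.  An edge of a total colouring avoids the colours of its two ends,
-- hence on a dart d it takes one of the two values
--
--   h (rot d)   or   h (rot² d).
--
-- Both choices define edge colourings, that is, they agree on a dart and its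
-- reverse: if x, u, v, y are consecutive vertices of the belt through d = uv,
-- then x is the head of rot² d and y the head of rot (rev d), and the colours
-- of x, u, v, y are distinct because the colours of a belt repeat with period
-- four.  Thus h (rot d) and h (rot (rev d)) are both the colour missing from
-- x, u, v; likewise h (rot² d) and h (rot² (rev d)) are both the colour missing
-- from u, v, y.  The same picture shows that d receives the colour of y in the
-- first choice and the colour of x in the second.  So, going clockwise around the
-- belt, a 0-coloured edge is followed at distance one by a 0-coloured vertex in
-- the first choice (reversed) and preceded at distance one by a 0-coloured vertex
-- in the second (directed).
--
-- Both choices are total colourings, since at each vertex they permute the head
-- colours cyclically.  A total colouring has distinct colours on the edges of a
-- 4-cycle with distinctly coloured vertices: two opposite edges together meet all
-- four vertices of the cycle, so a colour common to both edges would be missing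
-- from the vertices.
--
-- If the given colouring makes the first choice on d, then totality at the tail
-- of d forces the first choice on rot² d, and likewise the second choice on d
-- forces it on rot d.  The choices are invariant under rev, so connectedness
-- extends the choice made on one dart to all darts.

open import Defs
open import Data.Bool.Properties using (T-irrelevant; T-≡)
open import Data.Empty using (⊥)
open import Data.Fin using (Fin; punchOut)
open import Data.Fin.Patterns using (0F; 3F)
open import Data.Fin.Properties
  using (_≟_; all?; any?; injective⇒≤; punchOut-injective)
open import Data.Fin.Subset using (_∈_)
open import Data.Fin.Subset.Properties
  using (x∈⁅x⁆; x∈⁅y⁆⇒x≡y; x∈p∪q⁺; x∈p∪q⁻)
open import Data.Nat using (zero; suc; _+_)
open import Data.Nat.Properties using (1+n≰n; +-suc)
open import Data.Product using (∃-syntax; ∃!; _×_; _,_; proj₁; proj₂)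
open import Data.Sum using (_⊎_; inj₁; inj₂; [_,_]′)
open import Data.Vec.Properties using (lookup∘tabulate; []=⇒lookup; lookup⇒[]=)
open import Function.Base using (_∘_)
open import Function.Bundles using (Equivalence)
open import Function.Definitions using (Injective; Bijective)
open import Relation.Binary.Construct.Closure.ReflexiveTransitive using (Star; ε; _◅_)
open import Relation.Binary.PropositionalEquality
open import Relation.Nullary using (yes; no; contradiction)
open import Relation.Nullary.Decidable using (toWitness; ¬?; _→-dec_; _×-dec_; _⊎-dec_)

-- Finite combinatorics

-- An injective endofunction of a finite set takes each value exactly once.
injective⇒∃! : ∀ {n} {f : Fin n → Fin n} → Injective _≡_ _≡_ f →
               ∀ c → ∃! _≡_ λ i → f i ≡ c
injective⇒∃! {suc n} {f} inj c with any? (λ i → f i ≟ c)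
... | yes (i , fi≡c) = i , fi≡c , λ fj≡c → inj (trans fi≡c (sym fj≡c))
-- A missed value could be punched out, embedding Fin (suc n) into Fin n.
... | no missed = contradiction (injective⇒≤ squeezed) 1+n≰n
  where
  c≢f : ∀ i → c ≢ f i
  c≢f i c≡fi = missed (i , sym c≡fi)

  squeezed : Injective _≡_ _≡_ (λ i → punchOut (c≢f i))
  squeezed {i} {j} eq = inj (punchOut-injective (c≢f i) (c≢f j) eq)

-- Some colour avoids three given ones.
fourth-exists : ∀ (a b c : Fin 4) → ∃[ x ] x ≢ a × x ≢ b × x ≢ c
fourth-exists = toWitness
  {a? = all? λ a → all? λ b → all? λ c → any? λ x →
    ¬? (x ≟ a) ×-dec ¬? (x ≟ b) ×-dec ¬? (x ≟ c)} _

-- Only one colour avoids three distinct ones.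
fourth-unique : ∀ (a b c x y : Fin 4) → a ≢ b → a ≢ c → b ≢ c →
                x ≢ a → x ≢ b → x ≢ c → y ≢ a → y ≢ b → y ≢ c → x ≡ y
fourth-unique = toWitness
  {a? = all? λ a → all? λ b → all? λ c → all? λ x → all? λ y →
    ¬? (a ≟ b) →-dec ¬? (a ≟ c) →-dec ¬? (b ≟ c) →-dec
    ¬? (x ≟ a) →-dec ¬? (x ≟ b) →-dec ¬? (x ≟ c) →-dec
    ¬? (y ≟ a) →-dec ¬? (y ≟ b) →-dec ¬? (y ≟ c) →-dec x ≟ y} _

next⁴ : ∀ (i : Fin 4) → next (next (next (next i))) ≡ i
next⁴ = toWitness {a? = all? λ i → next (next (next (next i))) ≟ i} _

next²≢ : ∀ (i : Fin 4) → i ≢ next (next i)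
next²≢ = toWitness {a? = all? λ i → ¬? (i ≟ next (next i))} _

around : ∀ (i j : Fin 4) →
         j ≡ i ⊎ j ≡ next i ⊎ j ≡ next (next i) ⊎ j ≡ next (next (next i))
around = toWitness
  {a? = all? λ i → all? λ j →
    j ≟ i ⊎-dec j ≟ next i ⊎-dec j ≟ next (next i) ⊎-dec
    j ≟ next (next (next i))} _

-- Darts

module _ {G : Graph} where
  open Graph G using (V; Adj; N; N[_])

  dart-≡ : ∀ {d e : Dart G} → tail d ≡ tail e → head d ≡ head e → d ≡ e
  dart-≡ {dart u v a} {dart .u .v b} refl refl = cong (dart u v) (T-irrelevant a b)

  rev-rev : ∀ d → rev G (rev G d) ≡ d
  rev-rev d = dart-≡ refl refl

  ∈N[]⁺ : ∀ {u v} → Adj u v → v ∈ N[ u ]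
  ∈N[]⁺ {u} {v} a = x∈p∪q⁺ (inj₂ (lookup⇒[]= v (N u)
    (trans (lookup∘tabulate (Graph.adj G u) v) (Equivalence.to T-≡ a))))

  ∈N[]⁻ : ∀ {u v} → v ∈ N[ u ] → v ≡ u ⊎ Adj u v
  ∈N[]⁻ {u} {v} v∈ with x∈p∪q⁻ _ (N u) v∈
  ... | inj₁ v∈u = inj₁ (x∈⁅y⁆⇒x≡y u v∈u)
  ... | inj₂ v∈N = inj₂ (Equivalence.from T-≡
    (trans (sym (lookup∘tabulate (Graph.adj G u) v)) ([]=⇒lookup v∈N)))

  self∈N[] : ∀ {u} → u ∈ N[ u ]
  self∈N[] {u} = x∈p∪q⁺ (inj₁ (x∈⁅x⁆ u))

  -- In a connected graph, rot and rev act transitively on the darts.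
  spread : Connected G → (M : Embedding G) (P : Dart G → Set) →
           (∀ d → P d → P (rev G d)) → (∀ d → P d → P (Embedding.rot M d)) →
           ∀ d → P d → ∀ e → P e
  spread connected M P P-rev P-rot d Pd e =
    along (connected (tail d) (tail e)) (around-tail d Pd) e refl
    where
    open Embedding M

    P-rot^ : ∀ k d → P d → P ((rot ⟪ k ⟫) d)
    P-rot^ zero    d Pd = Pd
    P-rot^ (suc k) d Pd = P-rot _ (P-rot^ k d Pd)

    around-tail : ∀ d → P d → ∀ e → tail e ≡ tail d → P e
    around-tail d Pd e e∼d with k , refl ← rot-cyclic d e (sym e∼d) = P-rot^ k d Pd

    along : ∀ {u v} → Star Adj u v → (∀ e → tail e ≡ u → P e) →
            ∀ e → tail e ≡ v → P e
    along ε                 Pu = Pu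
    along (_◅_ {u} {w} a s) Pu =
      along s (around-tail (dart w u _) (P-rev (dart u w a) (Pu (dart u w a) refl)))

  -- Total colourings on 4-cycles

  -- Every 4-cycle has each of the four colours exactly once on its vertices,
  -- respectively on its edges.
  DistinctOnVertices DistinctOnEdges : Colouring G → Set
  DistinctOnVertices μ =
    ∀ (C : Cycle G 4) c → ∃! _≡_ λ i → onV μ (Cycle.vertex C i) ≡ c
  DistinctOnEdges μ =
    ∀ (C : Cycle G 4) c → ∃! _≡_ λ i → colour (onE μ) (Cycle.edge C i) ≡ c

  edges-distinct : ∀ {μ} → IsTotal G μ → DistinctOnVertices μ → DistinctOnEdges μ
  edges-distinct {μ} total on-vertices C = injective⇒∃! injective
    where
    open IsTotal total
    open Cycle C

    c : Fin 4 → Fin 4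
    c i = colour (onE μ) (edge i)

    c≢tail : ∀ i → onV μ (vertex i) ≢ c i
    c≢tail i = vertex-edge (edge i)

    c≢head : ∀ i → onV μ (vertex (next i)) ≢ c i
    c≢head i eq = vertex-edge (rev G (edge i)) (trans eq (sym (colour-rev (onE μ) (edge i))))

    consecutive : ∀ i → c i ≢ c (next i)
    consecutive i eq = edge-edge (rev G (edge i)) (edge (next i)) refl
      (λ eq′ → next²≢ i (distinct eq′)) (trans (colour-rev (onE μ) (edge i)) eq)

    -- The ends of two opposite edges are the four vertices of the cycle, and
    -- one of these has the colour of the first edge.
    opposite : ∀ i → c i ≢ c (next (next i))
    opposite i eq with j , κj≡ci , _ ← on-vertices C (c i) with around i j
    ... | inj₁ refl               = c≢tail i κj≡ci
    ... | inj₂ (inj₁ refl)        = c≢head i κj≡ci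
    ... | inj₂ (inj₂ (inj₁ refl)) = c≢tail (next (next i)) (trans κj≡ci eq)
    ... | inj₂ (inj₂ (inj₂ refl)) = c≢head (next (next i)) (trans κj≡ci eq)

    injective : Injective _≡_ _≡_ c
    injective {i} {j} eq with around i j
    ... | inj₁ refl               = refl
    ... | inj₂ (inj₁ refl)        = contradiction eq (consecutive i)
    ... | inj₂ (inj₂ (inj₁ refl)) = contradiction eq (opposite i)
    ... | inj₂ (inj₂ (inj₂ refl)) = contradiction
      (trans (sym eq) (cong c (sym (next⁴ i)))) (consecutive (next (next (next i))))

-- Rotation around a vertex

-- A vertex colouring κ under which every closed neighbourhood carries each colour
-- once, on an embedded graph.
module Neighbourhoods {G : Graph} (M : Embedding G) (κ : Graph.V G → Fin 4)
  (bijective : ∀ v → Bijective _≡_ _≡_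
    (λ (w : ∃[ u ] u ∈ Graph.N[_] G v) → κ (proj₁ w)))
  where
  open Graph G using (irrefl)
  open Embedding M

  -- The colour of the head of a dart.
  h : Dart G → Fin 4
  h d = κ (head d)

  tail≢head : ∀ d → κ (tail d) ≢ h d
  tail≢head (dart u v a) eq =
    irrefl v (subst (λ w → Graph.Adj G w v)
      (cong proj₁ (proj₁ (bijective u) {u , self∈N[] {G}} {v , ∈N[]⁺ {G} a} eq)) a)

  h-injective : ∀ {d e} → tail d ≡ tail e → h d ≡ h e → d ≡ e
  h-injective {dart u v a} {dart .u w b} refl eq =
    dart-≡ refl (cong proj₁ (proj₁ (bijective u) {v , ∈N[]⁺ {G} a} {w , ∈N[]⁺ {G} b} eq))

  neighbour : ∀ u c → c ≢ κ u → ∃[ d ] tail d ≡ u × h d ≡ c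
  neighbour u c c≢κu with (v , v∈) , is-c ← proj₂ (bijective u) c with ∈N[]⁻ {G} v∈
  ... | inj₁ refl = contradiction (sym (is-c refl)) c≢κu
  ... | inj₂ a    = dart u v a , refl , is-c refl

  rot²-tail : ∀ d → tail (rot (rot d)) ≡ tail d
  rot²-tail d = trans (rot-tail (rot d)) (rot-tail d)

  -- The orbit of rot at d cannot close within two darts, as their heads and the
  -- common tail would miss a colour.
  orbit-not-short : ∀ d → rot (rot d) ≡ d ⊎ rot (rot d) ≡ rot d → ⊥
  orbit-not-short d short
    with x , x≢κ , x≢h , x≢h′ ← fourth-exists (κ (tail d)) (h d) (h (rot d))
    with e , e∼d , he≡x ← neighbour (tail d) x x≢κ
    with k , refl ← rot-cyclic d e (sym e∼d)
    = [ (λ eq → x≢h (trans (sym he≡x) (cong h eq)))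
      , (λ eq → x≢h′ (trans (sym he≡x) (cong h eq))) ]′ (orbit k)
    where
    orbit : ∀ k → (rot ⟪ k ⟫) d ≡ d ⊎ (rot ⟪ k ⟫) d ≡ rot d
    orbit zero    = inj₁ refl
    orbit (suc k) with orbit k
    ... | inj₁ eq = inj₂ (cong rot eq)
    ... | inj₂ eq = [ inj₁ ∘ trans (cong rot eq) , inj₂ ∘ trans (cong rot eq) ]′ short

  h≢h-rot : ∀ d → h d ≢ h (rot d)
  h≢h-rot d eq = orbit-not-short d (inj₂ (sym (cong rot d≡rot-d)))
    where d≡rot-d = h-injective (sym (rot-tail d)) eq

  h≢h-rot² : ∀ d → h d ≢ h (rot (rot d))
  h≢h-rot² d eq = orbit-not-short d (inj₁ (sym (h-injective (sym (rot²-tail d)) eq)))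

  tail≢h-rot : ∀ d → κ (tail d) ≢ h (rot d)
  tail≢h-rot d eq = tail≢head (rot d) (trans (cong κ (rot-tail d)) eq)

  tail≢h-rot² : ∀ d → κ (tail d) ≢ h (rot (rot d))
  tail≢h-rot² d eq = tail≢head (rot (rot d)) (trans (cong κ (rot²-tail d)) eq)

  -- The head colour of rot³ d, like that of d, is the one missing from the tail
  -- and the heads of rot d and rot² d.
  rot³ : ∀ d → rot (rot (rot d)) ≡ d
  rot³ d = h-injective (trans (rot²-tail (rot d)) (rot-tail d))
    (fourth-unique (κ (tail d)) (h (rot d)) (h (rot (rot d))) _ _
      (tail≢h-rot d) (tail≢h-rot² d) (h≢h-rot (rot d))
      (λ eq → tail≢h-rot² (rot d) (trans (cong κ (rot-tail d)) (sym eq)))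
      (≢-sym (h≢h-rot² (rot d))) (≢-sym (h≢h-rot (rot (rot d))))
      (≢-sym (tail≢head d)) (h≢h-rot d) (h≢h-rot² d))

  same-tail : ∀ d e → tail d ≡ tail e → e ≡ d ⊎ e ≡ rot d ⊎ e ≡ rot (rot d)
  same-tail d e d∼e with k , refl ← rot-cyclic d e d∼e = orbit k
    where
    orbit : ∀ k → (rot ⟪ k ⟫) d ≡ d ⊎ (rot ⟪ k ⟫) d ≡ rot d ⊎ (rot ⟪ k ⟫) d ≡ rot (rot d)
    orbit zero    = inj₁ refl
    orbit (suc k) with orbit k
    ... | inj₁ eq        = inj₂ (inj₁ (cong rot eq))
    ... | inj₂ (inj₁ eq) = inj₂ (inj₂ (cong rot eq))
    ... | inj₂ (inj₂ eq) = inj₁ (trans (cong rot eq) (rot³ d))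

  -- The candidates for the colour of the edge of d: the colours of the two other
  -- neighbours of its tail.  The first one counterclockwise from d gives the
  -- reversed colouring, the second one the directed colouring.
  reversedColour directedColour : Dart G → Fin 4
  reversedColour d = h (rot d)
  directedColour d = h (rot (rot d))

  -- An edge colouring that is total with κ uses one of the two candidates on each
  -- dart, and the choice it makes on one dart propagates around the tail.
  module Choice (ν : EdgeColouring G) (total : IsTotal G ⟨ κ , ν ⟩) where
    open IsTotal total

    tail≢ : ∀ d → κ (tail d) ≢ colour ν d
    tail≢ = vertex-edge

    head≢ : ∀ d → h d ≢ colour ν d
    head≢ d eq = vertex-edge (rev G d) (trans eq (sym (colour-rev ν d)))

    directed-or-reversed : ∀ d → colour ν d ≡ directedColour d ⊎ colour ν d ≡ reversedColour d
    directed-or-reversed d with colour ν d ≟ reversedColour d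
    ... | yes eq = inj₂ eq
    ... | no ≢R  = inj₁ (fourth-unique (κ (tail d)) (h d) (h (rot d)) _ _
      (tail≢head d) (tail≢h-rot d) (h≢h-rot d)
      (≢-sym (tail≢ d)) (≢-sym (head≢ d)) ≢R
      (≢-sym (tail≢h-rot² d)) (≢-sym (h≢h-rot² d)) (≢-sym (h≢h-rot (rot d))))

    reversed-rot² : ∀ d → colour ν d ≡ reversedColour d →
                    colour ν (rot (rot d)) ≡ reversedColour (rot (rot d))
    reversed-rot² d eq with directed-or-reversed (rot (rot d))
    ... | inj₂ eq′ = eq′
    -- Otherwise rot² d would have the colour h (rot d) of d.
    ... | inj₁ eq′ = contradiction
      (trans eq (trans (cong (h ∘ rot) (sym (rot³ d))) (sym eq′)))
      (edge-edge d (rot (rot d)) (sym (rot²-tail d)) (h≢h-rot² d ∘ cong κ))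

    reversed-rot : ∀ d → colour ν d ≡ reversedColour d →
                   colour ν (rot d) ≡ reversedColour (rot d)
    reversed-rot d eq = subst (λ e → colour ν e ≡ reversedColour e)
      (cong rot (rot³ d)) (reversed-rot² (rot (rot d)) (reversed-rot² d eq))

    directed-rot : ∀ d → colour ν d ≡ directedColour d →
                   colour ν (rot d) ≡ directedColour (rot d)
    directed-rot d eq with directed-or-reversed (rot d)
    ... | inj₁ eq′ = eq′
    -- Otherwise rot d would have the colour h (rot² d) of d.
    ... | inj₂ eq′ = contradiction (trans eq (sym eq′))
      (edge-edge d (rot d) (sym (rot-tail d)) (h≢h-rot d ∘ cong κ))

  -- The two edge colourings

  -- The hypothesis says that a walk along three consecutive edges of a belt ends
  -- at a vertex whose colour differs from that of its start.
  module _ (far-ends : ∀ d → κ (tail d) ≢ h (φ (φ d))) where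

    -- The same hypothesis, stated for the middle dart of the three.
    around-edge : ∀ d → h (rot (rot d)) ≢ h (rot (rev G d))
    around-edge d eq = far-ends (rev G (rot (rot d)))
      (trans eq (cong (λ e → h (rot (rev G e))) (sym φ-before)))
      where
      φ-before : φ (rev G (rot (rot d))) ≡ d
      φ-before = trans (cong rot (rev-rev _)) (rot³ d)

    reversed-rev : ∀ d → reversedColour (rev G d) ≡ reversedColour d
    reversed-rev d = fourth-unique (κ (tail d)) (h d) (h (rot (rot d))) _ _
      (tail≢head d) (tail≢h-rot² d) (h≢h-rot² d)
      (≢-sym (h≢h-rot (rev G d))) (≢-sym (tail≢h-rot (rev G d))) (≢-sym (around-edge d))
      (≢-sym (tail≢h-rot d)) (≢-sym (h≢h-rot d)) (h≢h-rot (rot d))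

    directed-rev : ∀ d → directedColour (rev G d) ≡ directedColour d
    directed-rev d = fourth-unique (κ (tail d)) (h d) (h (rot (rev G d))) _ _
      (tail≢head d) (h≢h-rot (rev G d)) (tail≢h-rot (rev G d))
      (≢-sym (h≢h-rot² (rev G d))) (≢-sym (tail≢h-rot² (rev G d)))
      (≢-sym (h≢h-rot (rot (rev G d))))
      (≢-sym (tail≢h-rot² d)) (≢-sym (h≢h-rot² d)) (around-edge d)

    reversed directed : EdgeColouring G
    reversed = record { colour = reversedColour ; colour-rev = reversed-rev }
    directed = record { colour = directedColour ; colour-rev = directed-rev }

    reversed-total : IsTotal G ⟨ κ , reversed ⟩
    reversed-total = record
      { vertex-vertex = tail≢head
      ; vertex-edge   = tail≢h-rot
      ; edge-edge     = edge-edge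
      }
      where
      edge-edge : ∀ d e → tail d ≡ tail e → head d ≢ head e → h (rot d) ≢ h (rot e)
      edge-edge d e d∼e d≢e eq with same-tail d e d∼e
      ... | inj₁ refl        = d≢e refl
      ... | inj₂ (inj₁ refl) = h≢h-rot (rot d) eq
      ... | inj₂ (inj₂ refl) = h≢h-rot² (rot d) eq

    directed-total : IsTotal G ⟨ κ , directed ⟩
    directed-total = record
      { vertex-vertex = tail≢head
      ; vertex-edge   = tail≢h-rot²
      ; edge-edge     = edge-edge
      }
      where
      edge-edge : ∀ d e → tail d ≡ tail e → head d ≢ head e →
                  h (rot (rot d)) ≢ h (rot (rot e))
      edge-edge d e d∼e d≢e eq with same-tail d e d∼e
      ... | inj₁ refl        = d≢e refl
      ... | inj₂ (inj₁ refl) = h≢h-rot (rot (rot d)) eq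
      ... | inj₂ (inj₂ refl) = h≢h-rot² (rot (rot d)) eq

    orthogonal : OrthogonalEdgeColourings G directed reversed
    orthogonal d eq = h≢h-rot (rot d) (sym eq)

    same-everywhere : Connected G → Dart G → ∀ ν → IsTotal G ⟨ κ , ν ⟩ →
                      colour ν ≗ directedColour ⊎ colour ν ≗ reversedColour
    same-everywhere connected d ν total with Choice.directed-or-reversed ν total d
    ... | inj₁ eq = inj₁ (spread connected M (λ e → colour ν e ≡ directedColour e)
      (λ e eq → trans (colour-rev ν e) (trans eq (sym (directed-rev e))))
      (Choice.directed-rot ν total) d eq)
    ... | inj₂ eq = inj₂ (spread connected M (λ e → colour ν e ≡ reversedColour e)
      (λ e eq → trans (colour-rev ν e) (trans eq (sym (reversed-rev e))))
      (Choice.reversed-rot ν total) d eq)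

  -- Along a belt the reversed colour of an edge is the colour of the vertex one
  -- step after its head, and the directed colour that of the vertex one step
  -- before its tail.

  reversedColour-φ : (∀ d → reversedColour (rev G d) ≡ reversedColour d) →
                     ∀ d → κ (tail (φ (φ d))) ≡ reversedColour d
  reversedColour-φ rev-invariant d =
    trans (cong κ (rot-tail (rev G (φ d)))) (rev-invariant d)

  directedColour-φ : ∀ d → κ (tail d) ≡ directedColour (φ d)
  directedColour-φ d = cong h (sym (rot³ (rev G d)))

-- Belts

module _ {G : Graph} {M : Embedding G} where
  open Embedding M

  φ^-+ : ∀ i n d → (φ ⟪ n ⟫) d ≡ d → (φ ⟪ i + n ⟫) d ≡ (φ ⟪ i ⟫) d
  φ^-+ zero    n d eq = eq
  φ^-+ (suc i) n d eq = cong φ (φ^-+ i n d eq)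

  -- Every edge of a belt has a predecessor: the edge before the i-th has index
  -- i + (length - 1).
  predecessor : ∀ {d} (B : Belt G M d) i → ∃[ j ] Belt.edge B (suc j) ≡ Belt.edge B i
  predecessor {d} B i with Belt.length B | Belt.closes B | Cycle.long (Belt.boundary B)
  ... | suc n | closes | _ =
    i + n , trans (cong (λ k → (φ ⟪ k ⟫) d) (sym (+-suc i n))) (φ^-+ i (suc n) d closes)

  -- The 0-th and the third vertex of a period have different colours.
  periodic⇒far-ends : (κ : Graph.V G → Fin 4) → ∀ {d} (B : Belt G M d) →
    IsPeriodic G M κ B → κ (tail d) ≢ κ (head (φ (φ d)))
  periodic⇒far-ends κ B (_ , _ , p , (p-injective , _) , traces) eq =
    contradiction (p-injective p₀≡p₃) λ ()
    where
    p₀≡p₃ : p 0F ≡ p 3F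
    p₀≡p₃ = trans (sym (traces 0))
      (trans eq (trans (cong κ (sym (rot-tail _))) (traces 3)))

lemma27 : (G : Graph) → Connected G → Cubic G → Girth G 4 →
    (M : Embedding G) (Π : IsΠMap G M) (μ : Colouring G) → IsETGCOf G Π μ →
    ∃[ μᴰ ] ∃[ μᴿ ]
    OrthogonalEdgeColourings G μᴰ μᴿ ×
    IsDETGC G Π ⟨ onV μ , μᴰ ⟩ ×
    IsRETGC G Π ⟨ onV μ , μᴿ ⟩ ×
    Orthogonal G ⟨ onV μ , μᴰ ⟩ ⟨ onV μ , μᴿ ⟩ ×
    (SameColouring G μ ⟨ onV μ , μᴰ ⟩ ⊎ SameColouring G μ ⟨ onV μ , μᴿ ⟩)
lemma27 G connected _ (C₄ , _) M Π μ μ-isETGCOf =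
  μᴰ , μᴿ , orthogonal far-ends ,
  record { isETGCOf = etgcOf μᴰ totalᴰ ; directed = isDirected } ,
  record { isETGCOf = etgcOf μᴿ totalᴿ ; reversed = isReversed } ,
  record
    { isETCˡ        = etc μᴰ totalᴰ
    ; isETCʳ        = etc μᴿ totalᴿ
    ; same-vertices = λ _ → refl
    ; edges-differ  = orthogonal far-ends
    } ,
  -- The girth provides a dart on which to read off the choice made by μ.
  [ (λ eq → inj₁ ((λ _ → refl) , eq)) , (λ eq → inj₂ ((λ _ → refl) , eq)) ]′
    (same-everywhere far-ends connected (Cycle.edge C₄ 0F) (onE μ) (IsETC.total isETC))
  where
  open IsETGCOf μ-isETGCOf
  open IsETGC isETGC using (isETC; on-vertices)
  open IsETC isETC using (bijective; efficient)
  open IsΠMap Π using (isYMap; label; periodic)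
  open Embedding M using (φ)
  open Neighbourhoods M (onV μ) bijective

  far-ends : ∀ d → onV μ (tail d) ≢ h (φ (φ d))
  far-ends d eq = periodic⇒far-ends label belt (periodic belt)
    (trans (sym (labels _)) (trans eq (labels _)))
    where belt = IsMap.belt (IsYMap.isMap isYMap) d

  μᴰ μᴿ : EdgeColouring G
  μᴰ = directed far-ends
  μᴿ = reversed far-ends

  totalᴰ = directed-total far-ends
  totalᴿ = reversed-total far-ends

  etc : ∀ ν → IsTotal G ⟨ onV μ , ν ⟩ → IsETC G ⟨ onV μ , ν ⟩
  etc ν total = record { total = total ; bijective = bijective ; efficient = efficient }

  etgcOf : ∀ ν → IsTotal G ⟨ onV μ , ν ⟩ → IsETGCOf G Π ⟨ onV μ , ν ⟩
  etgcOf ν total = record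
    { isETGC = record
      { isETC       = etc ν total
      ; on-vertices = on-vertices
      ; on-edges    = edges-distinct total on-vertices
      }
    ; labels = labels
    }

  isDirected : ∀ {d} (B : Belt G M d) → IsDirected G Π ⟨ onV μ , μᴰ ⟩ B
  isDirected B i is-0 with j , eq ← predecessor B i =
    j , trans (directedColour-φ (Belt.edge B j)) (trans (cong directedColour eq) is-0) ,
    cong tail eq

  isReversed : ∀ {d} (B : Belt G M d) → IsReversed G Π ⟨ onV μ , μᴿ ⟩ B
  isReversed B i is-0 =
    suc i , trans (reversedColour-φ (reversed-rev far-ends) (Belt.edge B i)) is-0 ,
    Embedding.rot-tail M (rev G (Belt.edge B i))
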